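{- For every integer $v \ge 4$, \[ \beta(1,v,4) = \begin{cases} D(v,4) & \text{if } 4 \le v \le 13,\\ 13 & \text{if } 14 \le v \le 39,\\ \left\lfloor \frac{v-1}{3} \right\rfloor & \text{if } v \ge 40. \end{cases} \]
   Context: For integers $v \ge k \ge 2$, a $(v,k)$-packing is a pair $(X,\mathcal{B})$ where $X$ is a set of $v$ points and $\mathcal{B}$ is a set of $k$-subsets of $X$ (blocks) such that every pair of distinct points lies in at most one block. $D(v,k)$ denotes the maximum number of blocks in a $(v,k)$-packing. A partial parallel class (PPC) is a set of pairwise disjoint blocks; its size is the number of blocks. A PPC of size $\rho$ is maximum if the packing has no PPC of size $\rho+1$. $\beta(\rho,v,k)$ denotes the maximum number of blocks in a $(v,k)$-packing in which the maximum PPC has size $\rho$; thus $\beta(1,v,4)$ is the maximum number of blocks in a $(v,4)$-packing in which no two blocks are disjoint. -}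

module Defs where

open import Data.Nat using (ℕ; suc; _≤_)
open import Data.Fin using (Fin)
open import Data.Fin.Subset using (Subset; _∈_; _∩_; ∣_∣; Empty)
open import Data.List using (List; length)
open import Data.List.Relation.Unary.All using (All)
open import Data.List.Relation.Unary.AllPairs using (AllPairs)
open import Data.List.Relation.Unary.Unique.Propositional using (Unique)
import Data.List.Membership.Propositional as List
open import Data.List.Relation.Binary.Subset.Propositional using (_⊆_)
open import Data.Product using (_×_; Σ-syntax)
open import Relation.Binary.PropositionalEquality using (_≡_; _≢_)
open import Relation.Nullary using (¬_)

-- The point set is Fin v.  A set of blocks is a duplicate-free list, so its
-- cardinality is the length of the list.
record Packing (v k : ℕ) : Set where
  field
    blocks    : List (Subset v)
    unique    : Unique blocks
    blockSize : All (λ B → ∣ B ∣ ≡ k) blocks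
    pairOnce  : ∀ {x y : Fin v} → x ≢ y →
                ∀ {B C} → B List.∈ blocks → C List.∈ blocks →
                x ∈ B → y ∈ B → x ∈ C → y ∈ C → B ≡ C

  size : ℕ
  size = length blocks

open Packing public using (blocks; size)

record PPC {v k : ℕ} (P : Packing v k) (ρ : ℕ) : Set where
  field
    members  : List (Subset v)
    unique   : Unique members
    fromP    : members ⊆ blocks P
    disjoint : AllPairs (λ B C → Empty (B ∩ C)) members
    size≡    : length members ≡ ρ

MaxPPCSize : {v k : ℕ} → Packing v k → ℕ → Set
MaxPPCSize P ρ = PPC P ρ × ¬ PPC P (suc ρ)

IsMaximum : (ℕ → Set) → ℕ → Set
IsMaximum A n = A n × (∀ m → A m → m ≤ n)

-- D and β are maxima, given here by their graphs: D≔ v k n says that the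
-- maximum D(v,k) exists and equals n, and likewise β≔ ρ v k n for β(ρ,v,k).
-- Each relation determines n uniquely.
D≔ : (v k n : ℕ) → Set
D≔ v k n = IsMaximum (λ b → Σ[ P ∈ Packing v k ] size P ≡ b) n

β≔ : (ρ v k n : ℕ) → Set
β≔ ρ v k n =
  IsMaximum (λ b → Σ[ P ∈ Packing v k ] (MaxPPCSize P ρ × size P ≡ b)) n

{-# OPTIONS --safe #-}

-- Two double counts give the upper bounds.  Counting incidences and meeting
-- pairs of b blocks, and using (r − t)(r − t − 1) ≥ 0 for each point degree r,
-- gives 4b(2t + 1) ≤ b(b + 3) + v t(t + 1); for v ≤ 13 a suitable t makes this
-- fail for b = D(v,4) + 1.  If 14 or more blocks meet pairwise, the other 13
-- blocks meet a fixed block in one of its four points, so some point x lies on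
-- at least 5 blocks.  A block avoiding x would meet these 5 in distinct points,
-- so all blocks pass through x, and 3b ≤ v − 1.
-- The bounds are attained by the dual of K₅ and its subfamilies (v ≤ 10), by
-- the lines of PG(2,3) that survive the deletion of 0, 1 or 2 points
-- (11 ≤ v ≤ 13, and 14 ≤ v ≤ 39 after adding idle points), and by a star.
module Submission where

open import Data.Bool using (true; false)
open import Data.Fin using (Fin; zero; suc; toℕ; fromℕ; fromℕ<)
open import Data.Fin.Patterns
open import Data.Fin.Properties using (toℕ-fromℕ<)
open import Data.Fin.Subset using (Subset; inside; outside; _∈_; _∉_; _∩_; ∁; ⁅_⁆; ∣_∣; Nonempty)
open import Data.Fin.Subset.Properties using (_∈?_; nonempty?; ∣p∣≤∣x∷p∣; ∩-comm; ∩-idem; x∈p∩q⁺; x∈p∩q⁻; x∈⁅x⁆; x∈p⇒x∉∁p; ∣⁅x⁆∣≡1; ∣∁p∣≡n∸∣p∣)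
open import Data.List using (List; []; _∷_; length; map; filter; take)
open import Data.List.Properties using (length-map; length-take)
import Data.List.Membership.Propositional as List
open import Data.List.Membership.Propositional.Properties using (∈-filter⁻)
open import Data.List.Relation.Unary.All as All using (All; []; _∷_; all?)
import Data.List.Relation.Unary.All.Properties as All
open import Data.List.Relation.Unary.AllPairs as AllPairs using (AllPairs; []; _∷_; allPairs?)
import Data.List.Relation.Unary.AllPairs.Properties as AllPairs
open import Data.List.Relation.Unary.Any using (here; there)
open import Data.List.Relation.Unary.Unique.Propositional using (Unique)
open import Data.List.Relation.Unary.Unique.Propositional.Properties using (filter⁺)
open import Data.Nat using (ℕ; zero; suc; _+_; _*_; _∸_; _≤_; _<_; _≤′_; z≤n; s≤s; z<s; ≤′-refl; ≤′-step; _≟_; _<?_)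
open import Data.Nat.DivMod using (_/_; m/n≡1+[m∸n]/n; /-monoˡ-≤; m*n/n≡m)
open import Data.Nat.ListAction using (sum)
open import Data.Nat.Properties
open import Algebra.Properties.CommutativeSemigroup +-commutativeSemigroup using (x∙yz≈y∙xz; interchange)
open import Data.Nat.Tactic.RingSolver using (solve-∀)
import Data.List.Membership.DecPropositional _≟_ as ℕList
open import Data.Product using (_×_; _,_; proj₁; ∃-syntax; Σ-syntax)
open import Data.Sum using (_⊎_; inj₁; inj₂)
open import Data.Vec using ([]; _∷_; here; there; tail; tabulate)
open import Function using (_∘_)
open import Relation.Binary.PropositionalEquality using (_≡_; _≢_; refl; sym; trans; cong; cong₂; subst)
open import Relation.Nullary using (¬_; yes; no; does; contradiction)
open import Relation.Nullary.Decidable using (True; toWitness)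
open import Defs

private
  variable
    v b : ℕ

-- Cardinalities of finite subsets

∣p∣≤∣q∣+∣∁q∩p∣ : (q p : Subset v) → ∣ p ∣ ≤ ∣ q ∣ + ∣ ∁ q ∩ p ∣
∣p∣≤∣q∣+∣∁q∩p∣ [] [] = z≤n
∣p∣≤∣q∣+∣∁q∩p∣ (true ∷ q) (true ∷ p) = s≤s (∣p∣≤∣q∣+∣∁q∩p∣ q p)
∣p∣≤∣q∣+∣∁q∩p∣ (true ∷ q) (false ∷ p) = m≤n⇒m≤1+n (∣p∣≤∣q∣+∣∁q∩p∣ q p)
∣p∣≤∣q∣+∣∁q∩p∣ (false ∷ q) (true ∷ p) =
  ≤-trans (s≤s (∣p∣≤∣q∣+∣∁q∩p∣ q p)) (≤-reflexive (sym (+-suc ∣ q ∣ _)))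
∣p∣≤∣q∣+∣∁q∩p∣ (false ∷ q) (false ∷ p) = ∣p∣≤∣q∣+∣∁q∩p∣ q p

0<∣p∣⇒nonempty : {p : Subset v} → 0 < ∣ p ∣ → Nonempty p
0<∣p∣⇒nonempty {p = true ∷ p} _ = zero , here
0<∣p∣⇒nonempty {p = false ∷ p} 0<p with x , x∈p ← 0<∣p∣⇒nonempty 0<p = suc x , there x∈p

nonempty⇒0<∣p∣ : {p : Subset v} → Nonempty p → 0 < ∣ p ∣
nonempty⇒0<∣p∣ (zero , here) = z<s
nonempty⇒0<∣p∣ {p = s ∷ p} (suc x , there x∈p) =
  ≤-trans (nonempty⇒0<∣p∣ (x , x∈p)) (∣p∣≤∣x∷p∣ s p)

1<∣p∣⇒distinct : {p : Subset v} → 1 < ∣ p ∣ → ∃[ x ] ∃[ y ] x ≢ y × x ∈ p × y ∈ p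
1<∣p∣⇒distinct {p = true ∷ p} (s≤s 0<p) with y , y∈p ← 0<∣p∣⇒nonempty 0<p =
  zero , suc y , (λ ()) , here , there y∈p
1<∣p∣⇒distinct {p = false ∷ p} 1<p with x , y , x≢y , x∈p , y∈p ← 1<∣p∣⇒distinct 1<p =
  suc x , suc y , (λ { refl → x≢y refl }) , there x∈p , there y∈p

distinct⇒1<∣p∣ : {p : Subset v} {x y : Fin v} → x ≢ y → x ∈ p → y ∈ p → 1 < ∣ p ∣
distinct⇒1<∣p∣ x≢y here here = contradiction refl x≢y
distinct⇒1<∣p∣ x≢y here (there y∈p) = s≤s (nonempty⇒0<∣p∣ (_ , y∈p))
distinct⇒1<∣p∣ x≢y (there x∈p) here = s≤s (nonempty⇒0<∣p∣ (_ , x∈p))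
distinct⇒1<∣p∣ {p = s ∷ p} x≢y (there x∈p) (there y∈p) =
  ≤-trans (distinct⇒1<∣p∣ (x≢y ∘ cong suc) x∈p y∈p) (∣p∣≤∣x∷p∣ s p)

-- Sums and pairs over lists

module _ {A : Set} where

  sum-map-≤ : ∀ {f : A → ℕ} {c} {xs} → All (λ x → f x ≤ c) xs → sum (map f xs) ≤ length xs * c
  sum-map-≤ [] = z≤n
  sum-map-≤ (p ∷ ps) = +-mono-≤ p (sum-map-≤ ps)

  sum-map-≥ : ∀ {f : A → ℕ} {c} {xs} → All (λ x → c ≤ f x) xs → length xs * c ≤ sum (map f xs)
  sum-map-≥ [] = z≤n
  sum-map-≥ (p ∷ ps) = +-mono-≤ p (sum-map-≥ ps)

  unique⇒allPairs : ∀ {R : A → A → Set} {xs} → Unique xs →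
    (∀ {x y} → x List.∈ xs → y List.∈ xs → x ≢ y → R x y) → AllPairs R xs
  unique⇒allPairs [] f = []
  unique⇒allPairs (x≢xs ∷ u) f =
    All.tabulate (λ y∈ → f (here refl) (there y∈) (All.lookup x≢xs y∈)) ∷
    unique⇒allPairs u (λ x∈ y∈ → f (there x∈) (there y∈))

  allPairs⇒∈ : ∀ {R : A → A → Set} {xs} → AllPairs R xs →
    ∀ {x y} → x List.∈ xs → y List.∈ xs → x ≡ y ⊎ R x y ⊎ R y x
  allPairs⇒∈ (_ ∷ _) (here refl) (here refl) = inj₁ refl
  allPairs⇒∈ (r ∷ _) (here refl) (there y∈) = inj₂ (inj₁ (All.lookup r y∈))
  allPairs⇒∈ (r ∷ _) (there x∈) (here refl) = inj₂ (inj₂ (All.lookup r x∈))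
  allPairs⇒∈ (_ ∷ rs) (there x∈) (there y∈) = allPairs⇒∈ rs x∈ y∈

  unique⇒distinct : {xs : List A} → Unique xs → 1 < length xs →
    ∃[ x ] ∃[ y ] x ≢ y × x List.∈ xs × y List.∈ xs
  unique⇒distinct {xs = x ∷ y ∷ _} ((x≢y ∷ _) ∷ _) _ =
    x , y , x≢y , here refl , there (here refl)
  unique⇒distinct {xs = _ ∷ []} _ (s≤s ())

-- Double counting

degree : Fin v → List (Subset v) → ℕ
degree x bs = length (filter (x ∈?_) bs)

-- Incidences between points of `S` and blocks, counted block by block; `meets-inside` and
-- `meets-outside` recount them point by point.
meets : Subset v → List (Subset v) → ℕ
meets S bs = sum (map (λ C → ∣ S ∩ C ∣) bs)

totalMeets : List (Subset v) → List (Subset v) → ℕ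
totalMeets as bs = sum (map (λ A → meets A bs) as)

totalSize : List (Subset v) → ℕ
totalSize bs = sum (map ∣_∣ bs)

-- Induction on `v` deletes the point `zero` through `map tail`. The truncated blocks may coincide,
-- hence counts over lists with repetition.
degree-suc : (x : Fin v) (bs : List (Subset (suc v))) →
  degree (suc x) bs ≡ degree x (map tail bs)
degree-suc x [] = refl
degree-suc x ((_ ∷ C) ∷ bs) with does (x ∈? C)
... | true = cong suc (degree-suc x bs)
... | false = degree-suc x bs

meets-inside : (S : Subset v) (bs : List (Subset (suc v))) →
  meets (inside ∷ S) bs ≡ degree zero bs + meets S (map tail bs)
meets-inside S [] = refl
meets-inside S ((c ∷ C) ∷ bs) rewrite meets-inside S bs with c
... | true = cong suc (x∙yz≈y∙xz ∣ S ∩ C ∣ (degree zero bs) _)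
... | false = x∙yz≈y∙xz ∣ S ∩ C ∣ (degree zero bs) _

meets-outside : (S : Subset v) (bs : List (Subset (suc v))) →
  meets (outside ∷ S) bs ≡ meets S (map tail bs)
meets-outside S [] = refl
meets-outside S ((c ∷ C) ∷ bs) = cong (∣ S ∩ C ∣ +_) (meets-outside S bs)

meets-[] : (bs : List (Subset 0)) → meets [] bs ≡ 0
meets-[] [] = refl
meets-[] ([] ∷ bs) = meets-[] bs

-- `meets S bs` is the sum of the degrees of the points of `S`; if all were at most `m`, the sum
-- would be at most `∣ S ∣ * m`.
pigeonhole : ∀ m (S : Subset v) bs → ∣ S ∣ * m < meets S bs →
  ∃[ x ] x ∈ S × m < degree x bs
pigeonhole m [] bs 0<meets rewrite meets-[] bs = contradiction 0<meets (λ ())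
pigeonhole m (true ∷ S) bs lt with m <? degree zero bs
... | yes m<deg = zero , here , m<deg
... | no m≮deg
  with x , x∈S , m<deg ← pigeonhole m S (map tail bs)
         (+-cancelˡ-< (degree zero bs) _ _
           (≤-<-trans (+-monoˡ-≤ (∣ S ∣ * m) (≮⇒≥ m≮deg))
             (subst (m + ∣ S ∣ * m <_) (meets-inside S bs) lt)))
  = suc x , there x∈S , subst (m <_) (sym (degree-suc x bs)) m<deg
pigeonhole m (false ∷ S) bs lt
  with x , x∈S , m<deg ← pigeonhole m S (map tail bs) (subst (_ <_) (meets-outside S bs) lt)
  = suc x , there x∈S , subst (m <_) (sym (degree-suc x bs)) m<deg

totalSize-suc : (bs : List (Subset (suc v))) →
  totalSize bs ≡ degree zero bs + totalSize (map tail bs)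
totalSize-suc [] = refl
totalSize-suc ((c ∷ C) ∷ bs) rewrite totalSize-suc bs with c
... | true = cong suc (x∙yz≈y∙xz ∣ C ∣ (degree zero bs) _)
... | false = x∙yz≈y∙xz ∣ C ∣ (degree zero bs) _

totalSize-[] : (bs : List (Subset 0)) → totalSize bs ≡ 0
totalSize-[] [] = refl
totalSize-[] ([] ∷ bs) = totalSize-[] bs

-- The product counts the pairs of blocks sharing `zero`. Over all points, `totalMeets bs bs`
-- becomes the sum of squared degrees.
totalMeets-suc : (as bs : List (Subset (suc v))) →
  totalMeets as bs ≡ degree zero as * degree zero bs + totalMeets (map tail as) (map tail bs)
totalMeets-suc [] bs = refl
totalMeets-suc ((true ∷ A) ∷ as) bs
  rewrite totalMeets-suc as bs | meets-inside A bs =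
  interchange (degree zero bs) (meets A (map tail bs)) (degree zero as * degree zero bs) _
totalMeets-suc ((false ∷ A) ∷ as) bs
  rewrite totalMeets-suc as bs | meets-outside A bs =
  x∙yz≈y∙xz (meets A (map tail bs)) (degree zero as * degree zero bs) _

-- (n − t)(n − t − 1) ≥ 0, with the negative terms moved to the left.
consecutive : ∀ t n → (1 + 2 * t) * n ≤ n * n + t * (1 + t)
consecutive t n with ≤-total n t
... | inj₁ n≤t with k , refl ← m≤n⇒∃[o]m+o≡n n≤t =
  m+n≤o⇒m≤o _ {k * k + k} (≤-reflexive (identity n k))
  where
  identity : ∀ n k → (1 + 2 * (n + k)) * n + (k * k + k) ≡ n * n + (n + k) * (1 + (n + k))
  identity = solve-∀
... | inj₂ t≤n with m≤n⇒∃[o]m+o≡n t≤n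
...   | zero , refl = ≤-reflexive (identity t)
  where
  identity : ∀ t → (1 + 2 * t) * (t + 0) ≡ (t + 0) * (t + 0) + t * (1 + t)
  identity = solve-∀
...   | suc k , refl = m+n≤o⇒m≤o _ {k * k + k} (≤-reflexive (identity t k))
  where
  identity : ∀ t k → (1 + 2 * t) * (t + (1 + k)) + (k * k + k) ≡
                     (t + (1 + k)) * (t + (1 + k)) + t * (1 + t)
  identity = solve-∀

-- `consecutive` is summed over the points, with n the degree: `totalSize bs` is the sum of the
-- degrees, `totalMeets bs bs` that of their squares.
totalMeets-lowerBound : ∀ t (bs : List (Subset v)) →
  (1 + 2 * t) * totalSize bs ≤ totalMeets bs bs + v * (t * (1 + t))
totalMeets-lowerBound {zero} t bs rewrite totalSize-[] bs | *-zeroʳ (1 + 2 * t) = z≤n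
totalMeets-lowerBound {suc v} t bs
  rewrite totalMeets-suc bs bs | totalSize-suc bs = begin
  (1 + 2 * t) * (n + s)                ≡⟨ *-distribˡ-+ (1 + 2 * t) n s ⟩
  (1 + 2 * t) * n + (1 + 2 * t) * s    ≤⟨ +-mono-≤ (consecutive t n) (totalMeets-lowerBound t (map tail bs)) ⟩
  (n * n + c) + (m + v * c)            ≡⟨ interchange (n * n) c m (v * c) ⟩
  (n * n + m) + (c + v * c)            ∎
  where
  open ≤-Reasoning
  n = degree zero bs
  s = totalSize (map tail bs)
  m = totalMeets (map tail bs) (map tail bs)
  c = t * (1 + t)

-- `B` shares 4 points with itself and at most 1 with each of the other b - 1 blocks: 4 + (b - 1) =
-- 3 + b.
meets-upperBound : {bs : List (Subset v)} → All (λ B → ∣ B ∣ ≡ 4) bs →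
  AllPairs (λ B C → ∣ B ∩ C ∣ ≤ 1) bs → ∀ {B} → B List.∈ bs → meets B bs ≤ 3 + length bs
meets-upperBound {bs = B ∷ bs} (B≡4 ∷ _) (B∩ ∷ _) (here refl)
  rewrite ∩-idem B | B≡4 =
  +-monoʳ-≤ 4 (≤-trans (sum-map-≤ B∩) (≤-reflexive (*-identityʳ (length bs))))
meets-upperBound {bs = C ∷ bs} (_ ∷ sizes) (C∩ ∷ pairs) {B} (there B∈)
  rewrite ∩-comm B C =
  ≤-trans (+-mono-≤ (All.lookup C∩ B∈) (meets-upperBound sizes pairs B∈))
          (≤-reflexive (sym (+-suc 3 (length bs))))

linear⇒inequality : ∀ t {bs : List (Subset v)} → All (λ B → ∣ B ∣ ≡ 4) bs →
  AllPairs (λ B C → ∣ B ∩ C ∣ ≤ 1) bs →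
  (1 + 2 * t) * (length bs * 4) ≤ length bs * (3 + length bs) + v * (t * (1 + t))
linear⇒inequality {v} t {bs} sizes pairs = begin
  (1 + 2 * t) * (length bs * 4)
    ≤⟨ *-monoʳ-≤ (1 + 2 * t) (sum-map-≥ (All.map (λ B≡4 → ≤-reflexive (sym B≡4)) sizes)) ⟩
  (1 + 2 * t) * totalSize bs
    ≤⟨ totalMeets-lowerBound t bs ⟩
  totalMeets bs bs + v * (t * (1 + t))
    ≤⟨ +-monoˡ-≤ _ (sum-map-≤ (All.tabulate (meets-upperBound sizes pairs))) ⟩
  length bs * (3 + length bs) + v * (t * (1 + t)) ∎
  where open ≤-Reasoning

-- Upper bounds

-- Two common points would force the blocks to be equal.
linear : (P : Packing v 4) → AllPairs (λ B C → ∣ B ∩ C ∣ ≤ 1) (blocks P)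
linear P = unique⇒allPairs (Packing.unique P) λ {B} {C} B∈ C∈ B≢C → ≮⇒≥ λ 1<∣B∩C∣ →
  let x , y , x≢y , x∈ , y∈ = 1<∣p∣⇒distinct 1<∣B∩C∣
      x∈B , x∈C = x∈p∩q⁻ B C x∈
      y∈B , y∈C = x∈p∩q⁻ B C y∈
  in B≢C (Packing.pairOnce P x≢y B∈ C∈ x∈B y∈B x∈C y∈C)

-- The inequality is quadratic in the number of blocks, so it excludes only the
-- exact value 1 + d; a larger packing is first truncated to 1 + d blocks.
size≤ : ∀ t d → (1 + d) * (4 + d) + v * (t * (1 + t)) < (1 + 2 * t) * ((1 + d) * 4) →
  (P : Packing v 4) → size P ≤ d
size≤ {v} t d lt P = ≮⇒≥ λ d<size →
  let bs = take (1 + d) (blocks P)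
      len : length bs ≡ 1 + d
      len = trans (length-take (1 + d) (blocks P)) (m≤n⇒m⊓n≡m d<size)
  in <⇒≱ lt (subst (λ n → (1 + 2 * t) * (n * 4) ≤ n * (3 + n) + v * (t * (1 + t))) len
       (linear⇒inequality t (All.take⁺ (1 + d) (Packing.blockSize P))
                            (AllPairs.take⁺ (1 + d) (linear P))))

-- A point of `S` on two blocks of `ds` would form with `x` a pair covered twice. Applied to a block
-- missing `x` and to the complement of `x`.
meets-concurrent : (P : Packing v 4) {x : Fin v} {ds : List (Subset v)} → Unique ds →
  (∀ {D} → D List.∈ ds → D List.∈ blocks P × x ∈ D) →
  (S : Subset v) → x ∉ S → meets S ds ≤ ∣ S ∣ * 1
meets-concurrent P {x} {ds} u through S x∉S = ≮⇒≥ λ lt →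
  let y , y∈S , 1<deg = pigeonhole 1 S ds lt
      D , E , D≢E , D∈ , E∈ = unique⇒distinct (filter⁺ (y ∈?_) u) 1<deg
      D∈ds , y∈D = ∈-filter⁻ (y ∈?_) D∈
      E∈ds , y∈E = ∈-filter⁻ (y ∈?_) E∈
      D∈P , x∈D = through D∈ds
      E∈P , x∈E = through E∈ds
  in D≢E (Packing.pairOnce P (λ { refl → x∉S y∈S }) D∈P E∈P x∈D y∈D x∈E y∈E)

module _ (P : Packing v 4)
         (meet : ∀ {B C} → B List.∈ blocks P → C List.∈ blocks P → 0 < ∣ B ∩ C ∣)
         where

  -- If `C` missed `x`, each block through `x` would use up its own point of `C`, and `C` has only
  -- four.
  degree>4⇒concurrent : ∀ {x} → 4 < degree x (blocks P) → ∀ {C} → C List.∈ blocks P → x ∈ C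
  degree>4⇒concurrent {x} 4<deg {C} C∈ with x ∈? C
  ... | yes x∈C = x∈C
  ... | no x∉C = contradiction 4<deg (≤⇒≯ (begin
    length ds     ≡⟨ *-identityʳ _ ⟨
    length ds * 1 ≤⟨ sum-map-≥ (All.tabulate (λ D∈ → meet C∈ (proj₁ (through D∈)))) ⟩
    meets C ds    ≤⟨ meets-concurrent P (filter⁺ (x ∈?_) (Packing.unique P)) through C x∉C ⟩
    ∣ C ∣ * 1     ≡⟨ cong (_* 1) (All.lookup (Packing.blockSize P) C∈) ⟩
    4             ∎))
    where
    open ≤-Reasoning
    ds = filter (x ∈?_) (blocks P)
    through : ∀ {D} → D List.∈ ds → D List.∈ blocks P × x ∈ D
    through = ∈-filter⁻ (x ∈?_)

  -- Removing `x` leaves disjoint triples among the other v - 1 points.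
  concurrent⇒size≤ : ∀ {x} → (∀ {C} → C List.∈ blocks P → x ∈ C) → size P * 3 ≤ v ∸ 1
  concurrent⇒size≤ {x} through = begin
    size P * 3                 ≤⟨ sum-map-≥ (All.map rest (Packing.blockSize P)) ⟩
    meets (∁ ⁅ x ⁆) (blocks P) ≤⟨ meets-concurrent P (Packing.unique P)
                                    (λ D∈ → D∈ , through D∈)
                                    (∁ ⁅ x ⁆) (x∈p⇒x∉∁p (x∈⁅x⁆ x)) ⟩
    ∣ ∁ ⁅ x ⁆ ∣ * 1            ≡⟨ *-identityʳ _ ⟩
    ∣ ∁ ⁅ x ⁆ ∣                ≡⟨ ∣∁p∣≡n∸∣p∣ ⁅ x ⁆ ⟩
    v ∸ ∣ ⁅ x ⁆ ∣              ≡⟨ cong (v ∸_) (∣⁅x⁆∣≡1 x) ⟩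
    v ∸ 1                      ∎
    where
    open ≤-Reasoning
    rest : ∀ {D} → ∣ D ∣ ≡ 4 → 3 ≤ ∣ ∁ ⁅ x ⁆ ∩ D ∣
    rest {D} D≡4 with le ← ∣p∣≤∣q∣+∣∁q∩p∣ ⁅ x ⁆ D rewrite D≡4 | ∣⁅x⁆∣≡1 x = ≤-pred le

  -- The first block meets itself in 4 points and each of at least 13 others in one or more. These
  -- 17 > 4 * 4 incidences fall on its four points.
  degree>4 : 13 < size P → ∃[ x ] 4 < degree x (blocks P)
  degree>4 13<size = go (blocks P) refl 13<size
    where
    open ≤-Reasoning
    go : ∀ bs → bs ≡ blocks P → 13 < length bs → ∃[ x ] 4 < degree x (blocks P)
    go (B ∷ bs) refl (s≤s 13≤) = let x , _ , 4<deg = pigeonhole 4 B (B ∷ bs) lt in x , 4<deg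
      where
      B≡4 = All.lookup (Packing.blockSize P) (here refl)
      lt : ∣ B ∣ * 4 < meets B (B ∷ bs)
      lt = begin-strict
        ∣ B ∣ * 4              ≡⟨ cong (_* 4) B≡4 ⟩
        16                     <⟨ n<1+n 16 ⟩
        17                     ≤⟨ +-monoʳ-≤ 4 13≤ ⟩
        4 + length bs          ≡⟨ cong₂ _+_ (trans (cong ∣_∣ (∩-idem B)) B≡4) (*-identityʳ (length bs)) ⟨
        ∣ B ∩ B ∣ + length bs * 1
                               ≤⟨ +-monoʳ-≤ ∣ B ∩ B ∣ (sum-map-≥ (All.tabulate (λ C∈ → meet (here refl) (there C∈)))) ⟩
        meets B (B ∷ bs)       ∎

  size≤13⊎3*size≤v∸1 : size P ≤ 13 ⊎ size P * 3 ≤ v ∸ 1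
  size≤13⊎3*size≤v∸1 with 13 <? size P
  ... | no 13≮ = inj₁ (≮⇒≥ 13≮)
  ... | yes 13< with x , 4<deg ← degree>4 13< =
    inj₂ (concurrent⇒size≤ (degree>4⇒concurrent 4<deg))

¬PPC2⇒meet : (P : Packing v 4) → ¬ PPC P 2 →
  ∀ {B C} → B List.∈ blocks P → C List.∈ blocks P → 0 < ∣ B ∩ C ∣
¬PPC2⇒meet P ¬ppc {B} {C} B∈ C∈ with nonempty? (B ∩ C)
... | yes ne = nonempty⇒0<∣p∣ ne
... | no empty = contradiction (record
  { members = B ∷ C ∷ []
  ; unique = (B≢C ∷ []) ∷ [] ∷ []
  ; fromP = λ { (here refl) → B∈ ; (there (here refl)) → C∈ }
  ; disjoint = (empty ∷ []) ∷ [] ∷ []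
  ; size≡ = refl }) ¬ppc
  where
  B≢C : B ≢ C
  -- A block disjoint from itself would be empty.
  B≢C refl = empty (subst Nonempty (sym (∩-idem B))
    (0<∣p∣⇒nonempty (subst (0 <_) (sym (All.lookup (Packing.blockSize P) B∈)) z<s)))

-- Constructions

-- Exactly one common point encodes both the packing condition and the absence of disjoint blocks.
-- Distinctness follows, as a block meets itself in 4 points.
record Intersecting (v b : ℕ) : Set where
  field
    family : List (Subset v)
    sizes  : All (λ B → ∣ B ∣ ≡ 4) family
    pairs  : AllPairs (λ B C → ∣ B ∩ C ∣ ≡ 1) family
    length≡ : length family ≡ b

open Intersecting

module _ (F : Intersecting v b) where

  meetOnce : ∀ {B C} → B List.∈ family F → C List.∈ family F → B ≡ C ⊎ ∣ B ∩ C ∣ ≡ 1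
  meetOnce {B} {C} B∈ C∈ with allPairs⇒∈ (pairs F) B∈ C∈
  ... | inj₁ B≡C = inj₁ B≡C
  ... | inj₂ (inj₁ p) = inj₂ p
  ... | inj₂ (inj₂ p) = inj₂ (trans (cong ∣_∣ (∩-comm B C)) p)

  packing : Packing v 4
  packing = record
    { blocks = family F
    ; unique = distinct (sizes F) (pairs F)
    ; blockSize = sizes F
    ; pairOnce = pairOnce }
    where
    distinct : ∀ {bs : List (Subset v)} → All (λ B → ∣ B ∣ ≡ 4) bs →
      AllPairs (λ B C → ∣ B ∩ C ∣ ≡ 1) bs → Unique bs
    distinct [] [] = []
    distinct {B ∷ _} (B≡4 ∷ sizes) (B∩ ∷ pairs) =
      All.map (λ { B∩C≡1 refl → contradiction
        (trans (sym B≡4) (trans (cong ∣_∣ (sym (∩-idem B))) B∩C≡1)) (λ ()) }) B∩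
      ∷ distinct sizes pairs
    pairOnce : ∀ {x y : Fin v} → x ≢ y → ∀ {B C} → B List.∈ family F → C List.∈ family F →
      x ∈ B → y ∈ B → x ∈ C → y ∈ C → B ≡ C
    pairOnce x≢y B∈ C∈ x∈B y∈B x∈C y∈C with meetOnce B∈ C∈
    ... | inj₁ B≡C = B≡C
    ... | inj₂ B∩C≡1 = contradiction (sym B∩C≡1)
      (<⇒≢ (distinct⇒1<∣p∣ x≢y (x∈p∩q⁺ (x∈B , x∈C)) (x∈p∩q⁺ (y∈B , y∈C))))

  maxPPCSize : 0 < b → MaxPPCSize packing 1
  maxPPCSize 0<b = one (family F) refl (subst (0 <_) (sym (length≡ F)) 0<b) , ¬two
    where
    one : ∀ bs → bs ≡ family F → 0 < length bs → PPC packing 1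
    one (B ∷ _) refl _ = record
      { members = B ∷ []
      ; unique = [] ∷ []
      ; fromP = λ { (here refl) → here refl }
      ; disjoint = [] ∷ []
      ; size≡ = refl }
    ¬two : ¬ PPC packing 2
    ¬two record { members = B ∷ C ∷ []
                ; unique = (B≢C ∷ _) ∷ _
                ; fromP = fromP
                ; disjoint = (empty ∷ _) ∷ _ }
      with meetOnce (fromP (here refl)) (fromP (there (here refl)))
    ... | inj₁ B≡C = B≢C B≡C
    ... | inj₂ B∩C≡1 = empty (0<∣p∣⇒nonempty (subst (0 <_) (sym B∩C≡1) z<s))

  β-attained : 0 < b → Σ[ P ∈ Packing v 4 ] (MaxPPCSize P 1 × size P ≡ b)
  β-attained 0<b = packing , maxPPCSize 0<b , length≡ F

addPoint : Intersecting v b → Intersecting (suc v) b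
addPoint F = record
  { family = map (outside ∷_) (family F)
  ; sizes = All.map⁺ (sizes F)
  ; pairs = AllPairs.map⁺ (pairs F)
  ; length≡ = trans (length-map _ (family F)) (length≡ F) }

addPoints : ∀ {u} → u ≤′ v → Intersecting u b → Intersecting v b
addPoints ≤′-refl F = F
addPoints (≤′-step u≤v) F = addPoint (addPoints u≤v F)

fromPoints : ∀ v → List ℕ → Subset v
fromPoints v l = tabulate (λ i → does (toℕ i ℕList.∈? l))

-- Evaluation decides both conditions for a concrete table. `fromPoints` drops entries not below
-- `v`, but a four-entry block losing a point fails the size check.
explicit : ∀ v (ls : List (List ℕ)) → let bs = map (fromPoints v) ls in
  {True (all? (λ B → ∣ B ∣ ≟ 4) bs)} → {True (allPairs? (λ B C → ∣ B ∩ C ∣ ≟ 1) bs)} →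
  Intersecting v (length ls)
explicit v ls {sizes} {pairs} = record
  { family = map (fromPoints v) ls
  ; sizes = toWitness sizes
  ; pairs = toWitness pairs
  ; length≡ = length-map (fromPoints v) ls }

-- The points are the edges of K₅ and the blocks are its vertices.
dualK₅ : List (List ℕ)
dualK₅ =
  (0 ∷ 1 ∷ 2 ∷ 3 ∷ []) ∷
  (0 ∷ 4 ∷ 5 ∷ 6 ∷ []) ∷
  (1 ∷ 4 ∷ 7 ∷ 8 ∷ []) ∷
  (2 ∷ 5 ∷ 7 ∷ 9 ∷ []) ∷
  (3 ∷ 6 ∷ 8 ∷ 9 ∷ []) ∷ []

-- The translates of the difference set {0,1,3,9} modulo 13, sorted by largest
-- point: the first 6 avoid the points 11 and 12, the first 9 avoid 12.
PG⟨2,3⟩ : List (List ℕ)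
PG⟨2,3⟩ =
  (0 ∷ 4 ∷ 5 ∷ 7 ∷ []) ∷
  (1 ∷ 5 ∷ 6 ∷ 8 ∷ []) ∷
  (0 ∷ 1 ∷ 3 ∷ 9 ∷ []) ∷
  (2 ∷ 6 ∷ 7 ∷ 9 ∷ []) ∷
  (1 ∷ 2 ∷ 4 ∷ 10 ∷ []) ∷
  (3 ∷ 7 ∷ 8 ∷ 10 ∷ []) ∷
  (2 ∷ 3 ∷ 5 ∷ 11 ∷ []) ∷
  (4 ∷ 8 ∷ 9 ∷ 11 ∷ []) ∷
  (0 ∷ 6 ∷ 10 ∷ 11 ∷ []) ∷
  (3 ∷ 4 ∷ 6 ∷ 12 ∷ []) ∷
  (5 ∷ 9 ∷ 10 ∷ 12 ∷ []) ∷
  (1 ∷ 7 ∷ 11 ∷ 12 ∷ []) ∷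
  (0 ∷ 2 ∷ 8 ∷ 12 ∷ []) ∷ []

projectivePlane : Intersecting 13 13
projectivePlane = explicit 13 PG⟨2,3⟩

-- The common point of the star is the last one, so that the recursion can add
-- the three remaining points of a block in front.
starBlocks : ∀ n → List (Subset (suc n))
starBlocks (suc (suc (suc n))) =
  (inside ∷ inside ∷ inside ∷ ⁅ fromℕ n ⁆) ∷
  map (λ B → outside ∷ outside ∷ outside ∷ B) (starBlocks n)
starBlocks _ = []

-- Past its three new points a new block is `⁅ fromℕ n ⁆`, so this gives its intersections with the
-- older blocks.
starBlocks-hub : ∀ n → All (λ B → ∣ ⁅ fromℕ n ⁆ ∩ B ∣ ≡ 1) (starBlocks n)
starBlocks-hub 0 = []
starBlocks-hub 1 = []
starBlocks-hub 2 = []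
starBlocks-hub (suc (suc (suc n))) =
  trans (cong ∣_∣ (∩-idem ⁅ fromℕ n ⁆)) (∣⁅x⁆∣≡1 (fromℕ n)) ∷ All.map⁺ (starBlocks-hub n)

star : ∀ n → Intersecting (suc n) (n / 3)
star n = record { family = starBlocks n ; sizes = sizes′ n ; pairs = pairs′ n ; length≡ = length′ n }
  where
  sizes′ : ∀ n → All (λ B → ∣ B ∣ ≡ 4) (starBlocks n)
  sizes′ 0 = []
  sizes′ 1 = []
  sizes′ 2 = []
  sizes′ (suc (suc (suc n))) = cong (3 +_) (∣⁅x⁆∣≡1 (fromℕ n)) ∷ All.map⁺ (sizes′ n)
  pairs′ : ∀ n → AllPairs (λ B C → ∣ B ∩ C ∣ ≡ 1) (starBlocks n)
  pairs′ 0 = []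
  pairs′ 1 = []
  pairs′ 2 = []
  pairs′ (suc (suc (suc n))) = All.map⁺ (starBlocks-hub n) ∷ AllPairs.map⁺ (pairs′ n)
  length′ : ∀ n → length (starBlocks n) ≡ n / 3
  length′ 0 = refl
  length′ 1 = refl
  length′ 2 = refl
  length′ (suc (suc (suc n))) = trans (cong suc (trans (length-map _ (starBlocks n)) (length′ n)))
    (sym (m/n≡1+[m∸n]/n (m≤m+n 3 n)))

-- The three ranges of `v`

-- `size≤` bounds every packing, so an intersecting family reaching the bound settles D and β at
-- once.
D≔β : ∀ {d} t →
  {True ((1 + suc d) * (4 + suc d) + v * (t * (1 + t)) <? (1 + 2 * t) * ((1 + suc d) * 4))} →
  Intersecting v (suc d) → ∃[ d ] (D≔ v 4 d × β≔ 1 v 4 d)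
D≔β {d = d} t {lt} F = suc d ,
  ((packing F , length≡ F) , λ { _ (P , refl) → size≤ t (suc d) (toWitness lt) P }) ,
  (β-attained F z<s , λ { _ (P , _ , refl) → size≤ t (suc d) (toWitness lt) P })

D≔β-small : (i : Fin 10) → ∃[ d ] (D≔ (4 + toℕ i) 4 d × β≔ 1 (4 + toℕ i) 4 d)
-- Each `t` satisfies t ≤ 4b/v ≤ t + 1 with b one above the maximum, 4b/v being the average degree
-- to be excluded. The first 1, 2, 3 and 5 blocks of `dualK₅` occupy 4, 7, 9 and 10 points.
D≔β-small 0F = D≔β 1 (explicit 4 (take 1 dualK₅))
D≔β-small 1F = D≔β 1 (explicit 5 (take 1 dualK₅))
D≔β-small 2F = D≔β 1 (explicit 6 (take 1 dualK₅))
D≔β-small 3F = D≔β 1 (explicit 7 (take 2 dualK₅))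
D≔β-small 4F = D≔β 1 (explicit 8 (take 2 dualK₅))
D≔β-small 5F = D≔β 1 (explicit 9 (take 3 dualK₅))
D≔β-small 6F = D≔β 2 (explicit 10 dualK₅)
D≔β-small 7F = D≔β 2 (explicit 11 (take 6 PG⟨2,3⟩))
D≔β-small 8F = D≔β 3 (explicit 12 (take 9 PG⟨2,3⟩))
D≔β-small 9F = D≔β 4 projectivePlane

β≔13 : 13 ≤ v → v ≤ 39 → β≔ 1 v 4 13
β≔13 {v} 13≤v v≤39 = β-attained (addPoints (≤⇒≤′ 13≤v) projectivePlane) z<s ,
  λ { _ (P , (_ , ¬ppc) , refl) → bound P (size≤13⊎3*size≤v∸1 P (¬PPC2⇒meet P ¬ppc)) }
  where
  bound : (P : Packing v 4) → size P ≤ 13 ⊎ size P * 3 ≤ v ∸ 1 → size P ≤ 13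
  bound P (inj₁ le) = le
  -- Concurrent blocks give 3b ≤ 38 < 42 = 14 * 3.
  bound P (inj₂ le) = ≤-pred (*-cancelʳ-< 3 (size P) 14
    (≤-<-trans le (≤-<-trans (∸-monoˡ-≤ 1 v≤39) (m≤m+n 39 3))))

β≔star : 40 ≤ v → β≔ 1 v 4 ((v ∸ 1) / 3)
β≔star {suc n} (s≤s 39≤n) = β-attained (star n) (≤-trans z<s 13≤n/3) ,
  λ { _ (P , (_ , ¬ppc) , refl) → bound P (size≤13⊎3*size≤v∸1 P (¬PPC2⇒meet P ¬ppc)) }
  where
  -- From v = 40 on, the star is at least as large as the plane: 39 / 3 = 13.
  13≤n/3 : 13 ≤ n / 3
  13≤n/3 = /-monoˡ-≤ 3 39≤n
  bound : (P : Packing (suc n) 4) → size P ≤ 13 ⊎ size P * 3 ≤ n → size P ≤ n / 3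
  bound P (inj₁ le) = ≤-trans le 13≤n/3
  bound P (inj₂ le) = subst (_≤ n / 3) (m*n/n≡m (size P) 3) (/-monoˡ-≤ 3 le)

theorem4p1 : ∀ (v : ℕ) → 4 ≤ v →
    (v ≤ 13 → ∃[ d ] (D≔ v 4 d × β≔ 1 v 4 d)) ×
    (14 ≤ v → v ≤ 39 → β≔ 1 v 4 13) ×
    (40 ≤ v → β≔ 1 v 4 ((v ∸ 1) / 3))
theorem4p1 v 4≤v = small , (λ 14≤v → β≔13 (≤-trans (n≤1+n 13) 14≤v)) , β≔star
  where
  small : v ≤ 13 → ∃[ d ] (D≔ v 4 d × β≔ 1 v 4 d)
  small v≤13 with k , refl ← m≤n⇒∃[o]m+o≡n 4≤v =
    subst (λ k → ∃[ d ] (D≔ (4 + k) 4 d × β≔ 1 (4 + k) 4 d)) (toℕ-fromℕ< k<10)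
      (D≔β-small (fromℕ< k<10))
    where
    k<10 : k < 10
    k<10 = s≤s (+-cancelˡ-≤ 4 _ _ v≤13)
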